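{- Let $n\ge 1$, let $V$ be a set with $|V|=n$, and let $M\subseteq[n]$ with $l(M)=l$. Suppose that $\mathcal{A},\mathcal{B}\subseteq 2^V$ and that the pair $(\mathcal{A},\mathcal{B})$ is $M$-intersecting. Then $$|\mathcal{A}||\mathcal{B}|<2.631^n\cdot 10^{4l+10}.$$ Moreover, if $n$ is sufficiently large, then also $$|\mathcal{A}||\mathcal{B}|<2^{\,n+2l\log^2 n},$$ where $\log$ denotes the binary logarithm. That is, $|\mathcal{A}||\mathcal{B}|<\min\{2.631^n\cdot 10^{4l+10},\,2^{n+2l\log^2 n}\}$ for $n$ sufficiently large.
   Context: $[n]:=\{0,1,\ldots,n\}$. For a set $M$ of integers, $l(M)$ (the length of $M$) is the maximum number of consecutive integers contained in $M$. A pair $(\mathcal{A},\mathcal{B})$ of families of subsets of $V$ is $M$-intersecting if $|A\cap B|\in M$ for every $A\in\mathcal{A}$ and $B\in\mathcal{B}$. -}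

module Defs where

open import Algebra.Definitions.RawSemiring using () renaming (_^_ to pow)
open import Data.Fin.Subset using (Subset; ∣_∣; _∩_)
open import Data.Integer.Base as ℤ using (ℤ; +_; -[1+_])
open import Data.List.Base using (List; length)
import Data.List.Membership.Propositional as List
open import Data.List.Relation.Unary.Unique.Propositional using (Unique)
open import Data.Nat.Base as ℕ using (ℕ; zero; suc)
open import Data.Product.Base using (∃; ∃-syntax; _×_)
open import Data.Rational.Base as ℚ using (ℚ; 0ℚ; ½; ↥_; ↧ₙ_)
open import Data.Sum.Base using (_⊎_)
open import Level using (0ℓ)
open import Relation.Unary using (Pred; _∈_)

-- Sets of integers.  Only subsets of {0, …, n} matter, so they are
-- predicates on ℕ.

[_] : ℕ → Pred ℕ 0ℓ
[ n ] m = m ℕ.≤ n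

HasRun : Pred ℕ 0ℓ → ℕ → Set
HasRun M k = ∃[ a ] (∀ i → i ℕ.< k → a ℕ.+ i ∈ M)

-- l(M) = l; in particular the empty set has length 0.
HasLength : Pred ℕ 0ℓ → ℕ → Set
HasLength M l = HasRun M l × (∀ k → HasRun M k → k ℕ.≤ l)

-- Families of subsets of an n-element set, listed without repetition.

record Family (n : ℕ) : Set where
  constructor family
  field
    members : List (Subset n)
    unique  : Unique members

open Family public

infix 4 _∈ᶠ_
_∈ᶠ_ : ∀ {n} → Subset n → Family n → Set
A ∈ᶠ 𝒜 = A List.∈ members 𝒜

∥_∥ : ∀ {n} → Family n → ℕ
∥ 𝒜 ∥ = length (members 𝒜)

Intersecting : ∀ {n} → Pred ℕ 0ℓ → Family n → Family n → Set
Intersecting M 𝒜 ℬ = ∀ A B → A ∈ᶠ 𝒜 → B ∈ᶠ ℬ → ∣ A ∩ B ∣ ∈ M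

infixr 8 _^_
_^_ : ℚ → ℕ → ℚ
_^_ = pow ℚ.+-*-rawSemiring

fromℕ : ℕ → ℚ
fromℕ n = + n ℚ./ 1

2^ℤ_ : ℤ → ℚ
2^ℤ (+ k)    = fromℕ 2 ^ k
2^ℤ -[1+ k ] = ½ ^ suc k

-- A real r is represented by its open lower cut { q ∈ ℚ ∣ q < r }, so that
-- membership of q in the cut is the strict inequality q < r.

ℝ : Set₁
ℝ = Pred ℚ 0ℓ

infix 4 _<ᴿ_
_<ᴿ_ : ℚ → ℝ → Set
q <ᴿ r = r q

ratᴿ : ℚ → ℝ
ratᴿ p q = q ℚ.< p

infixl 6 _+ᴿ_
_+ᴿ_ : ℝ → ℝ → ℝ
(r +ᴿ s) q = ∃[ a ] ∃[ b ] a <ᴿ r × b <ᴿ s × q ℚ.≤ a ℚ.+ b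

-- The product of nonnegative reals only.  The first disjunct is needed when
-- a factor is 0, whose cut has no nonnegative member.
infixl 7 _*ᴿ_
_*ᴿ_ : ℝ → ℝ → ℝ
(r *ᴿ s) q =
  q ℚ.< 0ℚ ⊎
  (∃[ a ] ∃[ b ] 0ℚ ℚ.≤ a × 0ℚ ℚ.≤ b × a <ᴿ r × b <ᴿ s × q ℚ.≤ a ℚ.* b)

-- For q = c / d with d > 0:  q < log₂ n  iff  2 ^ c < n ^ d.
-- (For n ≥ 1 this is the real number log₂ n ≥ 0; for n = 0 the cut is empty.)
log₂ : ℕ → ℝ
log₂ n q = 2^ℤ (↥ q) ℚ.< fromℕ n ^ (↧ₙ q)

-- For q = c / d with d > 0 and y ≥ 0:  y < 2 ^ q  iff  y ^ d < 2 ^ c.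
2^ℚ_ : ℚ → ℝ
(2^ℚ q) y = y ℚ.< 0ℚ ⊎ y ^ (↧ₙ q) ℚ.< 2^ℤ (↥ q)

-- 2 ^ r is the supremum of 2 ^ q over the rationals q < r.
2^ᴿ_ : ℝ → ℝ
(2^ᴿ r) y = ∃[ q ] q <ᴿ r × y <ᴿ 2^ℚ q

{-# OPTIONS --safe #-}
module Submission where

open import Algebra.Bundles using (CommutativeRing)
import Algebra.Properties.CommutativeSemiring.Exp as Exp
open import Data.Bool.Base using (Bool; true; false; T; _∧_; _∨_; _xor_; if_then_else_)
import Data.Bool.Properties as Bool
open import Data.Bool.Properties using (T-∧; T-∨)
open import Data.Fin.Subset using (Subset; _∩_) renaming (∣_∣ to card; ⊥ to ∅)
open import Data.Fin.Subset.Properties using (∩-comm; ∣p∣≤n)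
open import Data.Integer.Base using (+_)
import Data.Integer.Base as ℤ
import Data.Integer.Properties as ℤ
open import Data.List.Base using (List; []; _∷_; length)
import Data.List.Membership.DecPropositional as DecMembership
open import Data.List.Membership.Propositional using (_∈_)
open import Data.List.Relation.Unary.All.Properties using (All¬⇒¬Any)
open import Data.List.Relation.Unary.AllPairs using ([]; _∷_)
open import Data.List.Relation.Unary.Any using (here; there)
open import Data.List.Relation.Unary.Unique.Propositional using (Unique)
open import Data.Nat.Base using (ℕ; _≤_; _+_; _*_)
open import Data.Nat.Base using (zero; suc; _<_; _≡ᵇ_; _<ᵇ_; z≤n; s≤s; z<s; s≤s⁻¹; s<s; s<s⁻¹; NonZero) renaming (_^_ to _^ᴺ_)
open import Data.Nat.Coprimality as Coprime using (1-coprimeTo)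
open import Data.Nat.Properties
open import Data.Nat.Tactic.RingSolver using (solve-∀)
open import Data.Product.Base using (∃-syntax; _×_)
open import Data.Product.Base using (_,_; proj₁; proj₂)
open import Data.Rational.Base as ℚ using (ℚ)
import Data.Rational.Properties as ℚ
open import Data.Sum.Base using (_⊎_; inj₁; inj₂)
open import Data.Unit.Base using (⊤; tt)
open import Data.Vec.Base using ([]; _∷_; zipWith)
open import Data.Vec.Properties using (≡-dec; zipWith-identityˡ)
open import Function.Base using (_∘_)
open import Function.Bundles using (Equivalence)
open import Level using (0ℓ)
open import Relation.Binary.PropositionalEquality hiding ([_])
open import Relation.Nullary using (¬_; contradiction; Dec; isYes)
open import Relation.Nullary.Decidable using (toWitness; fromWitness)
open import Relation.Unary using (Pred; _⊆_)
open import Defs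

open Equivalence using (to; from)

-- Split P and Q along the first coordinate into P₀, P₁ and Q₀, Q₁.  Both
-- (P₀ ∪ P₁, Q₀) and (P₁, Q₁) still avoid runs longer than l, while
-- (P₀ ∩ P₁, Q₁) is (M ∩ (M − 1))-intersecting, which shortens the runs by one.
--
-- Exponential bound: as |P₀ ∩ P₁||Q₁| is negligible, so is P₀ ∩ P₁ unless Q₁ is
-- small, and |P||Q₀|, |P₀||Q| and |P₁||Q₁| are essentially bounded in dimension
-- n − 1.  If q₀, p₀ are the densities of Q₀, P₀, then one of q₀, p₀ and
-- (1 − p₀)(1 − q₀) is at least 1/φ² for the golden ratio φ, and φ² < 2.631.
--
-- Quasipolynomial bound: in fact |P||Q| ≤ 2ⁿ (n+1)³ˡ.  If |Q₁| ≤ |Q₀| at every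
-- step along the all-zero branch, then each step costs a factor of about 2, or
-- decreases l.  A general Q is brought into this form by the symmetric difference
-- with its majority branch w, at the cost of signs on w and of fixing |A ∩ w|.

private
  variable
    n : ℕ

-- Families as Boolean functions on the cube, and their sizes.

𝔽 : ℕ → Set
𝔽 n = Subset n → Bool

infixl 20 _₀ _₁
_₀ _₁ : 𝔽 (suc n) → 𝔽 n
(P ₀) A = P (false ∷ A)
(P ₁) A = P (true ∷ A)

infixr 7 _⊓ᶠ_
infixr 6 _⊔ᶠ_
_⊔ᶠ_ _⊓ᶠ_ : 𝔽 n → 𝔽 n → 𝔽 n
(P ⊔ᶠ Q) A = P A ∨ Q A
(P ⊓ᶠ Q) A = P A ∧ Q A

-- Counting by recursion on the first coordinate makes the split of a family into its two halves
-- hold by definition, as the inductions below require.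
size : 𝔽 n → ℕ
size {zero}  P = if P [] then 1 else 0
size {suc n} P = size (P ₀) + size (P ₁)

+-interchange : ∀ a b c d → (a + b) + (c + d) ≡ (a + c) + (b + d)
+-interchange = solve-∀

size-⊔-⊓ : (P Q : 𝔽 n) → size (P ⊔ᶠ Q) + size (P ⊓ᶠ Q) ≡ size P + size Q
size-⊔-⊓ {zero} P Q with P [] | Q []
... | true  | true  = refl
... | true  | false = refl
... | false | true  = refl
... | false | false = refl
size-⊔-⊓ {suc n} P Q = begin
  (size (P ₀ ⊔ᶠ Q ₀) + size (P ₁ ⊔ᶠ Q ₁)) + (size (P ₀ ⊓ᶠ Q ₀) + size (P ₁ ⊓ᶠ Q ₁))
    ≡⟨ +-interchange (size (P ₀ ⊔ᶠ Q ₀)) _ _ _ ⟩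
  (size (P ₀ ⊔ᶠ Q ₀) + size (P ₀ ⊓ᶠ Q ₀)) + (size (P ₁ ⊔ᶠ Q ₁) + size (P ₁ ⊓ᶠ Q ₁))
    ≡⟨ cong₂ _+_ (size-⊔-⊓ (P ₀) (Q ₀)) (size-⊔-⊓ (P ₁) (Q ₁)) ⟩
  (size (P ₀) + size (Q ₀)) + (size (P ₁) + size (Q ₁))
    ≡⟨ +-interchange (size (P ₀)) _ _ _ ⟩
  (size (P ₀) + size (P ₁)) + (size (Q ₀) + size (Q ₁)) ∎
  where open ≡-Reasoning

size-mono : (P Q : 𝔽 n) → (∀ A → T (P A) → T (Q A)) → size P ≤ size Q
size-mono {zero} P Q P⊆Q with P [] | Q [] | P⊆Q []
... | true  | true  | _ = ≤-refl
... | true  | false | h = contradiction (h tt) λ ()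
... | false | _     | _ = z≤n
size-mono {suc n} P Q P⊆Q =
  +-mono-≤ (size-mono (P ₀) (Q ₀) (P⊆Q ∘ (false ∷_))) (size-mono (P ₁) (Q ₁) (P⊆Q ∘ (true ∷_)))

size-mono-< : (P Q : 𝔽 n) → (∀ A → T (P A) → T (Q A)) → ∀ A → ¬ T (P A) → T (Q A) → size P < size Q
size-mono-< P Q P⊆Q [] ¬PA QA with P [] | Q []
... | true  | _    = contradiction tt ¬PA
... | false | true = z<s
size-mono-< P Q P⊆Q (false ∷ A) ¬PA QA =
  +-mono-<-≤ (size-mono-< (P ₀) (Q ₀) (P⊆Q ∘ (false ∷_)) A ¬PA QA)
             (size-mono (P ₁) (Q ₁) (P⊆Q ∘ (true ∷_)))
size-mono-< P Q P⊆Q (true ∷ A) ¬PA QA =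
  +-mono-≤-< (size-mono (P ₀) (Q ₀) (P⊆Q ∘ (false ∷_)))
             (size-mono-< (P ₁) (Q ₁) (P⊆Q ∘ (true ∷_)) A ¬PA QA)

size-⊓≤⊔ : (P Q : 𝔽 n) → size (P ⊓ᶠ Q) ≤ size (P ⊔ᶠ Q)
size-⊓≤⊔ P Q = size-mono (P ⊓ᶠ Q) (P ⊔ᶠ Q) λ A h → from (T-∨ {P A}) (inj₁ (proj₁ (to (T-∧ {P A}) h)))

inhabited? : (P : 𝔽 n) → size P ≡ 0 ⊎ (∃[ A ] T (P A))
inhabited? {zero} P with P [] in eq
... | true  = inj₂ ([] , subst T (sym eq) tt)
... | false = inj₁ refl
inhabited? {suc n} P with inhabited? (P ₀) | inhabited? (P ₁)
... | inj₂ (A , h) | _            = inj₂ (false ∷ A , h)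
... | inj₁ _       | inj₂ (A , h) = inj₂ (true ∷ A , h)
... | inj₁ e       | inj₁ e′      = inj₁ (cong₂ _+_ e e′)

-- Symmetric differences and signed intersection counts.

infixl 7 _⊕_
_⊕_ : Subset n → Subset n → Subset n
_⊕_ = zipWith _xor_

size-⊕ : (P : 𝔽 n) (w : Subset n) → size (λ A → P (A ⊕ w)) ≡ size P
size-⊕ P []          = refl
size-⊕ P (false ∷ w) = cong₂ _+_ (size-⊕ (P ₀) w) (size-⊕ (P ₁) w)
size-⊕ P (true ∷ w)  =
  trans (+-comm (size (λ A → P (true ∷ (A ⊕ w)))) _)
        (cong₂ _+_ (size-⊕ (P ₀) w) (size-⊕ (P ₁) w))

bit : Bool → ℕ
bit true  = 1
bit false = 0

card-∷ : ∀ b (A : Subset n) → card (b ∷ A) ≡ bit b + card A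
card-∷ true  A = refl
card-∷ false A = refl

-- The bits of σ are signs (true is −): up to the additive constant card σ,
-- ⟨ σ ∣ A , B ⟩ is the signed count of the elements of A ∩ B.
⟨_∣_,_⟩ : Subset n → Subset n → Subset n → ℕ
⟨ σ ∣ A , B ⟩ = card (σ ⊕ (A ∩ B))

⟨⟩-∷ : ∀ s x y (σ A B : Subset n) →
  ⟨ s ∷ σ ∣ x ∷ A , y ∷ B ⟩ ≡ bit (s xor (x ∧ y)) + ⟨ σ ∣ A , B ⟩
⟨⟩-∷ s x y σ A B = card-∷ (s xor (x ∧ y)) (σ ⊕ (A ∩ B))

-- Off `w` nothing changes. An element of `A` in `w` with sign ε lies in exactly one of `B` and
-- `B ⊕ w`, so it adds ε - ε[i ∈ B] to the count for `B ⊕ w`: a constant depending on `A` and `w`,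
-- plus the count for `B` with reversed sign. The two `card` offsets of `σ` cancel.
⟨⟩-flip : (σ w A B : Subset n) →
  ⟨ σ ⊕ w ∣ A , B ⟩ + ⟨ σ ∣ A , w ⟩ ≡ ⟨ σ ∣ A , B ⊕ w ⟩ + card (σ ⊕ w)
⟨⟩-flip [] [] [] [] = refl
⟨⟩-flip (s ∷ σ) (v ∷ w) (x ∷ A) (y ∷ B) = begin
  ⟨ (s ∷ σ) ⊕ (v ∷ w) ∣ x ∷ A , y ∷ B ⟩ + ⟨ s ∷ σ ∣ x ∷ A , v ∷ w ⟩
    ≡⟨ cong₂ _+_ (⟨⟩-∷ (s xor v) x y (σ ⊕ w) A B) (⟨⟩-∷ s x v σ A w) ⟩
  (bit ((s xor v) xor (x ∧ y)) + ⟨ σ ⊕ w ∣ A , B ⟩) + (bit (s xor (x ∧ v)) + ⟨ σ ∣ A , w ⟩)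
    ≡⟨ +-interchange (bit ((s xor v) xor (x ∧ y))) _ _ _ ⟩
  (bit ((s xor v) xor (x ∧ y)) + bit (s xor (x ∧ v))) + (⟨ σ ⊕ w ∣ A , B ⟩ + ⟨ σ ∣ A , w ⟩)
    ≡⟨ cong₂ _+_ (bits s v x y) (⟨⟩-flip σ w A B) ⟩
  (bit (s xor (x ∧ (y xor v))) + bit (s xor v)) + (⟨ σ ∣ A , B ⊕ w ⟩ + card (σ ⊕ w))
    ≡⟨ +-interchange (bit (s xor (x ∧ (y xor v)))) _ _ _ ⟩
  (bit (s xor (x ∧ (y xor v))) + ⟨ σ ∣ A , B ⊕ w ⟩) + (bit (s xor v) + card (σ ⊕ w))
    ≡⟨ cong₂ _+_ (⟨⟩-∷ s x (y xor v) σ A (B ⊕ w)) (card-∷ (s xor v) (σ ⊕ w)) ⟨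
  ⟨ s ∷ σ ∣ x ∷ A , (y xor v) ∷ (B ⊕ w) ⟩ + card ((s xor v) ∷ (σ ⊕ w)) ∎
  where
  open ≡-Reasoning
  bits : ∀ s v x y → bit ((s xor v) xor (x ∧ y)) + bit (s xor (x ∧ v))
                   ≡ bit (s xor (x ∧ (y xor v))) + bit (s xor v)
  bits false v     false y     = trans (cong (λ b → bit b + 0) (Bool.xor-identityʳ v)) (+-comm (bit v) 0)
  bits true  false false y     = refl
  bits true  true  false y     = refl
  bits false false true  false = refl
  bits false false true  true  = refl
  bits false true  true  false = refl
  bits false true  true  true  = refl
  bits true  false true  false = refl
  bits true  false true  true  = refl
  bits true  true  true  false = refl
  bits true  true  true  true  = refl

-- Signed intersecting pairs and the runs of their value sets.

Cross : Subset n → Pred ℕ 0ℓ → 𝔽 n → 𝔽 n → Set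
Cross σ M P Q = ∀ A B → T (P A) → T (Q B) → M ⟨ σ ∣ A , B ⟩

-- The upper half of `HasLength`: unlike the exact length, it is inherited by shifted sets.
RunsAtMost : Pred ℕ 0ℓ → ℕ → Set
RunsAtMost M l = ∀ k → HasRun M k → k ≤ l

shift : ℕ → Pred ℕ 0ℓ → Pred ℕ 0ℓ
shift d M m = M (d + m)

-- The set M + d - c, with the subtraction moved across the equation so that everything stays in ℕ.
translated : Pred ℕ 0ℓ → ℕ → ℕ → Pred ℕ 0ℓ
translated M c d m = ∃[ x ] M x × m + c ≡ x + d

doubled : Pred ℕ 0ℓ → Pred ℕ 0ℓ
doubled M m = M m × M (suc m)

runs-shift : ∀ M {l} d → RunsAtMost M l → RunsAtMost (shift d M) l
runs-shift M d short k (a , run) =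
  short k (d + a , λ i i<k → subst M (sym (+-assoc d a i)) (run i i<k))

-- A nonempty run of `doubled M` extends by one further element in `M`. An empty run does not, hence
-- the separate case.
runs-doubled : ∀ M {l} → RunsAtMost M (suc l) → RunsAtMost (doubled M) l
runs-doubled M short zero    _         = z≤n
runs-doubled M short (suc k) (a , run) = s≤s⁻¹ (short (2 + k) (a , run′))
  where
  run′ : ∀ i → i < 2 + k → M (a + i)
  run′ zero    _   = proj₁ (run 0 z<s)
  run′ (suc i) i<k = subst M (sym (+-suc a i)) (proj₂ (run i (s<s⁻¹ i<k)))

Cross-sym : ∀ (σ : Subset n) M {P Q} → Cross σ M P Q → Cross σ M Q P
Cross-sym σ M h A B PA QB = subst (λ C → M (card (σ ⊕ C))) (∩-comm B A) (h B A QB PA)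

module _ (s : Bool) (σ : Subset n) (M : Pred ℕ 0ℓ) (P Q : 𝔽 (suc n))
         (cross : Cross (s ∷ σ) M P Q) where

  private
    at : ∀ x y A B → T (P (x ∷ A)) → T (Q (y ∷ B)) →
         M (bit (s xor (x ∧ y)) + ⟨ σ ∣ A , B ⟩)
    at x y A B PA QB = subst M (⟨⟩-∷ s x y σ A B) (cross (x ∷ A) (y ∷ B) PA QB)

  -- As `B` omits the first coordinate, that coordinate contributes the same amount whether or not
  -- `A` contains it.
  Cross-⊔ : Cross σ (shift (bit (s xor false)) M) (P ₀ ⊔ᶠ P ₁) (Q ₀)
  Cross-⊔ A B PA QB with to (T-∨ {P (false ∷ A)}) PA
  ... | inj₁ P₀A = at false false A B P₀A QB
  ... | inj₂ P₁A = at true  false A B P₁A QB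

  -- Both extensions of `A` lie in `P`, and `B` contains the first coordinate, so two consecutive
  -- values occur; the sign `s` decides which of them is the larger.
  Cross-⊓ : Cross σ (doubled M) (P ₀ ⊓ᶠ P ₁) (Q ₁)
  Cross-⊓ A B PA QB with to (T-∧ {P (false ∷ A)}) PA
  ... | P₀A , P₁A = order s (at false true A B P₀A QB) (at true true A B P₁A QB)
    where
    order : ∀ s {m} → M (bit (s xor false) + m) → M (bit (s xor true) + m) → doubled M m
    order false h₀ h₁ = h₀ , h₁
    order true  h₀ h₁ = h₁ , h₀

  Cross-₁₁ : Cross σ (shift (bit (s xor true)) M) (P ₁) (Q ₁)
  Cross-₁₁ A B = at true true A B

-- A single value in `M` would already be a run of length one.
Cross-empty : ∀ (σ : Subset n) M P Q → RunsAtMost M 0 → Cross σ M P Q → size P * size Q ≡ 0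
Cross-empty σ M P Q short cross with inhabited? P | inhabited? Q
... | inj₁ e        | _             = cong (_* size Q) e
... | inj₂ _        | inj₁ e        = trans (cong (size P *_) e) (*-zeroʳ (size P))
... | inj₂ (A , PA) | inj₂ (B , QB) =
  contradiction (short 1 (⟨ σ ∣ A , B ⟩ , run)) λ ()
  where
  run : ∀ i → i < 1 → M (⟨ σ ∣ A , B ⟩ + i)
  run zero    _        = subst M (sym (+-identityʳ _)) (cross A B PA QB)
  run (suc _) (s<s ())

-- Since ⟨ σ ∣ A , w ⟩ = c for all A ∈ P, replacing B by B ⊕ w only translates
-- the signed count once the signs on w are reversed.
Cross-flip : ∀ (σ : Subset n) M P Q w c → Cross σ M P Q → (∀ A → T (P A) → ⟨ σ ∣ A , w ⟩ ≡ c) →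
  Cross (σ ⊕ w) (translated M c (card (σ ⊕ w))) P (λ B → Q (B ⊕ w))
Cross-flip σ M P Q w c cross const A B PA QB =
  _ , cross A (B ⊕ w) PA QB ,
  trans (cong (_+_ ⟨ σ ⊕ w ∣ A , B ⟩) (sym (const A PA))) (⟨⟩-flip σ w A B)

runs-translate : ∀ M {l} c d → RunsAtMost M l → RunsAtMost (translated M c d) l
runs-translate M c d short zero    _         = z≤n
runs-translate M c d short (suc k) (a , run) with run 0 z<s
-- The preimage `x₀` of the first element starts the run in `M`: cancelling `d` forces the preimage
-- of `a + i` to be `x₀ + i`.
... | x₀ , _ , eq₀ = short (suc k) (x₀ , run′)
  where
  run′ : ∀ i → i < suc k → M (x₀ + i)
  run′ i i<k with run i i<k
  ... | x , Mx , eq = subst M (+-cancelʳ-≡ d x (x₀ + i) (begin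
    x + d             ≡⟨ eq ⟨
    a + i + c         ≡⟨ e₁ a i c ⟩
    (a + 0 + c) + i   ≡⟨ cong (_+ i) eq₀ ⟩
    (x₀ + d) + i      ≡⟨ e₂ x₀ d i ⟩
    (x₀ + i) + d      ∎)) Mx
    where
    open ≡-Reasoning
    e₁ : ∀ a i c → a + i + c ≡ (a + 0 + c) + i
    e₁ = solve-∀
    e₂ : ∀ x d i → (x + d) + i ≡ (x + i) + d
    e₂ = solve-∀

-- Quasipolynomial bound for balanced families.

Balanced : 𝔽 n → Set
Balanced {zero}  Q = ⊤
Balanced {suc n} Q = size (Q ₁) ≤ size (Q ₀) × Balanced (Q ₀)

-- Greedy choice: `w` records the larger half at each coordinate, and translation by `w` moves that
-- half to the zero side.
balance : (Q : 𝔽 n) → ∃[ w ] Balanced (λ B → Q (B ⊕ w))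
balance {zero}  Q = [] , tt
balance {suc n} Q with ≤-total (size (Q ₁)) (size (Q ₀))
... | inj₁ q₁≤q₀ with balance (Q ₀)
...   | w , bal = false ∷ w ,
  subst₂ _≤_ (sym (size-⊕ (Q ₁) w)) (sym (size-⊕ (Q ₀) w)) q₁≤q₀ , bal
balance {suc n} Q | inj₂ q₀≤q₁ with balance (Q ₁)
...   | w , bal = true ∷ w ,
  subst₂ _≤_ (sym (size-⊕ (Q ₀) w)) (sym (size-⊕ (Q ₁) w)) q₀≤q₁ , bal

-- If q₁ is at most the fraction 1/(m+2) of q₀ + q₁, then passing to q₀ loses a
-- factor (m+2)/(m+1), which the factor suc m of the bound absorbs.
balanced-step : ∀ m {u w p q₀ q₁ t f K} →
  p ≡ u + w → w ≤ u → q₁ ≤ q₀ →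
  u * q₀ ≤ t * (suc m * K) → w * q₁ ≤ t * f → (2 + m) * f ≤ K →
  p * (q₀ + q₁) ≤ 2 * t * ((2 + m) * K)
balanced-step m {u} {w} {_} {q₀} {q₁} {t} {f} {K} refl w≤u q₁≤q₀ uq₀ wq₁ f≤K
  with ≤-total ((2 + m) * q₁) (q₀ + q₁)
... | inj₁ small = *-cancelˡ-≤ (suc m) (begin
    suc m * ((u + w) * (q₀ + q₁))              ≡⟨ e₁ m u w (q₀ + q₁) ⟩
    (u + w) * (suc m * (q₀ + q₁))              ≤⟨ *-mono-≤ (+-monoʳ-≤ u w≤u) q≤ ⟩
    (u + u) * ((2 + m) * q₀)                   ≡⟨ e₂ m u q₀ ⟩
    2 * (2 + m) * (u * q₀)                     ≤⟨ *-monoʳ-≤ (2 * (2 + m)) uq₀ ⟩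
    2 * (2 + m) * (t * (suc m * K))            ≡⟨ e₃ m t K ⟩
    suc m * (2 * t * ((2 + m) * K))            ∎)
  where
  open ≤-Reasoning
  e₁ : ∀ m u w q → suc m * ((u + w) * q) ≡ (u + w) * (suc m * q)
  e₁ = solve-∀
  e₂ : ∀ m u q → (u + u) * ((2 + m) * q) ≡ 2 * (2 + m) * (u * q)
  e₂ = solve-∀
  e₃ : ∀ m t K → 2 * (2 + m) * (t * (suc m * K)) ≡ suc m * (2 * t * ((2 + m) * K))
  e₃ = solve-∀
  e₄ : ∀ m a b → suc m * (a + b) + (a + b) ≡ (2 + m) * a + (2 + m) * b
  e₄ = solve-∀
  q≤ : suc m * (q₀ + q₁) ≤ (2 + m) * q₀
  q≤ = +-cancelʳ-≤ (q₀ + q₁) _ _ (begin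
    suc m * (q₀ + q₁) + (q₀ + q₁)  ≡⟨ e₄ m q₀ q₁ ⟩
    (2 + m) * q₀ + (2 + m) * q₁    ≤⟨ +-monoʳ-≤ ((2 + m) * q₀) small ⟩
    (2 + m) * q₀ + (q₀ + q₁)       ∎)
-- Here q₀ + q₁ is at most (m+2)q₁, so the intersection part `w` adds at most (m+2)tf ≤ tK, within
-- the 2tK by which the target exceeds the main term.
... | inj₂ large = begin
    (u + w) * (q₀ + q₁)                        ≡⟨ *-distribʳ-+ (q₀ + q₁) u w ⟩
    u * (q₀ + q₁) + w * (q₀ + q₁)
      ≤⟨ +-mono-≤ (*-monoʳ-≤ u (+-monoʳ-≤ q₀ q₁≤q₀)) (*-monoʳ-≤ w large) ⟩
    u * (q₀ + q₀) + w * ((2 + m) * q₁)         ≡⟨ e₁ m u w q₀ q₁ ⟩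
    2 * (u * q₀) + (2 + m) * (w * q₁)          ≤⟨ +-mono-≤ (*-monoʳ-≤ 2 uq₀) (*-monoʳ-≤ (2 + m) wq₁) ⟩
    2 * (t * (suc m * K)) + (2 + m) * (t * f)  ≡⟨ e₂ m t K f ⟩
    2 * t * (suc m * K) + t * ((2 + m) * f)    ≤⟨ +-monoʳ-≤ (2 * t * (suc m * K)) (*-monoʳ-≤ t f≤K) ⟩
    2 * t * (suc m * K) + t * K                ≤⟨ m≤m+n _ (t * K) ⟩
    2 * t * (suc m * K) + t * K + t * K        ≡⟨ e₃ m t K ⟩
    2 * t * ((2 + m) * K)                      ∎
  where
  open ≤-Reasoning
  e₁ : ∀ m u w a b → u * (a + a) + w * ((2 + m) * b) ≡ 2 * (u * a) + (2 + m) * (w * b)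
  e₁ = solve-∀
  e₂ : ∀ m t K f → 2 * (t * (suc m * K)) + (2 + m) * (t * f) ≡ 2 * t * (suc m * K) + t * ((2 + m) * f)
  e₂ = solve-∀
  e₃ : ∀ m t K → 2 * t * (suc m * K) + t * K + t * K ≡ 2 * t * ((2 + m) * K)
  e₃ = solve-∀

size-[]≤1 : (P : 𝔽 0) → size P ≤ 1
size-[]≤1 P with P []
... | true  = ≤-refl
... | false = z≤n

Bound : ℕ → ℕ → ℕ → Set₁
Bound m l f = ∀ (σ : Subset m) M P Q → RunsAtMost M l → Cross σ M P Q → size P * size Q ≤ 2 ^ᴺ m * f

-- Induction along the all-zero branch: `Q ₀` is again balanced and keeps the run length, while
-- `Q ₁` may be unbalanced but is met with shorter runs, where `ih` applies. The fixed `N` bounds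
-- all dimensions, so that one `f` serves the whole branch.
balanced-bound : ∀ {N l f} → 1 ≤ f → (∀ m → m ≤ N → Bound m l f) →
  ∀ m → m ≤ N → (σ : Subset m) → ∀ M P Q → RunsAtMost M (suc l) → Cross σ M P Q → Balanced Q →
  size P * size Q ≤ 2 ^ᴺ m * (suc m * (suc N * f))
balanced-bound {N} {l} {f} 1≤f ih zero _ σ M P Q short cross _ = begin
  size P * size Q            ≤⟨ *-mono-≤ (size-[]≤1 P) (size-[]≤1 Q) ⟩
  1                          ≤⟨ *-mono-≤ (z<s {N}) 1≤f ⟩
  suc N * f                  ≡⟨ e (suc N * f) ⟩
  1 * (1 * (suc N * f))      ∎
  where
  open ≤-Reasoning
  e : ∀ x → x ≡ 1 * (1 * x)
  e = solve-∀
balanced-bound {N} {l} {f} 1≤f ih (suc m) m<N (s ∷ σ) M P Q short cross (q₁≤q₀ , bal) =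
  balanced-step m {t = 2 ^ᴺ m} {f} (sym (size-⊔-⊓ (P ₀) (P ₁))) (size-⊓≤⊔ (P ₀) (P ₁)) q₁≤q₀
    (balanced-bound 1≤f ih m (<⇒≤ m<N) σ (shift (bit (s xor false)) M) (P ₀ ⊔ᶠ P ₁) (Q ₀)
      (runs-shift M (bit (s xor false)) short) (Cross-⊔ s σ M P Q cross) bal)
    (ih m (<⇒≤ m<N) σ (doubled M) (P ₀ ⊓ᶠ P ₁) (Q ₁) (runs-doubled M short) (Cross-⊓ s σ M P Q cross))
    (*-monoˡ-≤ f (s≤s m<N))

-- From balanced to arbitrary families, by fibres of the count on `w`.

fibre : (Subset n → ℕ) → ℕ → 𝔽 n → 𝔽 n
fibre g c P A = P A ∧ (g A ≡ᵇ c)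

below : (Subset n → ℕ) → ℕ → 𝔽 n → 𝔽 n
below g k P A = P A ∧ (g A <ᵇ k)

-- Union bound, adding one fibre at a time.
size-below : ∀ (P : 𝔽 n) g {q X} → (∀ c → size (fibre g c P) * q ≤ X) →
  ∀ k → size (below g k P) * q ≤ k * X
size-below P g {q} fib zero with inhabited? (below g 0 P)
... | inj₁ e       = ≤-reflexive (cong (_* q) e)
... | inj₂ (A , h) = contradiction (<ᵇ⇒< (g A) 0 (proj₂ (to (T-∧ {P A}) h))) λ ()
size-below P g {q} {X} fib (suc k) = begin
  size (below g (suc k) P) * q  ≤⟨ *-monoˡ-≤ q (size-mono _ (fibre g k P ⊔ᶠ below g k P) split) ⟩
  size (fibre g k P ⊔ᶠ below g k P) * q
    ≤⟨ *-monoˡ-≤ q (m≤m+n (size (fibre g k P ⊔ᶠ below g k P)) (size (fibre g k P ⊓ᶠ below g k P))) ⟩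
  (size (fibre g k P ⊔ᶠ below g k P) + size (fibre g k P ⊓ᶠ below g k P)) * q
    ≡⟨ cong (_* q) (size-⊔-⊓ (fibre g k P) (below g k P)) ⟩
  (size (fibre g k P) + size (below g k P)) * q  ≡⟨ *-distribʳ-+ q (size (fibre g k P)) _ ⟩
  size (fibre g k P) * q + size (below g k P) * q  ≤⟨ +-mono-≤ (fib k) (size-below P g fib k) ⟩
  X + k * X ∎
  where
  open ≤-Reasoning
  split : ∀ A → T (below g (suc k) P A) → T ((fibre g k P ⊔ᶠ below g k P) A)
  split A h with to (T-∧ {P A}) h
  ... | PA , gA<1+k with m≤n⇒m<n∨m≡n (s≤s⁻¹ (<ᵇ⇒< (g A) (suc k) gA<1+k))
  ...   | inj₁ gA<k = from (T-∨ {fibre g k P A}) (inj₂ (from (T-∧ {P A}) (PA , <⇒<ᵇ gA<k)))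
  ...   | inj₂ gA≡k = from (T-∨ {fibre g k P A}) (inj₁ (from (T-∧ {P A}) (PA , ≡⇒≡ᵇ (g A) k gA≡k)))

size-fibres : ∀ (P : 𝔽 n) g {q X} N → (∀ A → g A ≤ N) → (∀ c → size (fibre g c P) * q ≤ X) →
  size P * q ≤ suc N * X
size-fibres P g {q} N g≤N fib = ≤-trans
  (*-monoˡ-≤ q (size-mono P (below g (suc N) P) λ A PA → from (T-∧ {P A}) (PA , <⇒<ᵇ (s≤s (g≤N A)))))
  (size-below P g fib (suc N))

-- Each unit of `l` costs three factors of at most N + 1: the number of values of `⟨ σ ∣ A , w ⟩`,
-- fixed so that `Q` may be balanced, and the two factors of `balanced-bound`.
polynomial-bound : ∀ N l m → m ≤ N → Bound m l ((suc N ^ᴺ 3) ^ᴺ l)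
polynomial-bound N zero m m≤N σ M P Q short cross = ≤-trans (≤-reflexive (Cross-empty σ M P Q short cross)) z≤n
polynomial-bound N (suc l) m m≤N σ M P Q short cross with balance Q
... | w , bal = begin
  size P * size Q                             ≤⟨ size-fibres P ⟨ σ ∣_, w ⟩ m (λ A → ∣p∣≤n (σ ⊕ (A ∩ w))) each ⟩
  suc m * (2 ^ᴺ m * (suc m * (suc N * f)))
    ≤⟨ *-mono-≤ (s≤s m≤N) (*-monoʳ-≤ (2 ^ᴺ m) (*-monoˡ-≤ (suc N * f) (s≤s m≤N))) ⟩
  suc N * (2 ^ᴺ m * (suc N * (suc N * f)))     ≡⟨ e (suc N) (2 ^ᴺ m) f ⟩
  2 ^ᴺ m * (suc N ^ᴺ 3 * f)                     ∎
  where
  open ≤-Reasoning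
  f = (suc N ^ᴺ 3) ^ᴺ l
  e : ∀ x t f → x * (t * (x * (x * f))) ≡ t * (x * (x * (x * 1)) * f)
  e = solve-∀
  each : ∀ c → size (fibre ⟨ σ ∣_, w ⟩ c P) * size Q ≤ 2 ^ᴺ m * (suc m * (suc N * f))
  each c = begin
    size (fibre ⟨ σ ∣_, w ⟩ c P) * size Q
      ≡⟨ cong (size (fibre ⟨ σ ∣_, w ⟩ c P) *_) (size-⊕ Q w) ⟨
    size (fibre ⟨ σ ∣_, w ⟩ c P) * size (λ B → Q (B ⊕ w))
      ≤⟨ balanced-bound (m^n>0 (suc N ^ᴺ 3) {{m^n≢0 (suc N) 3}} l) (polynomial-bound N l) m m≤N
           (σ ⊕ w) (translated M c (card (σ ⊕ w))) (fibre ⟨ σ ∣_, w ⟩ c P) (λ B → Q (B ⊕ w))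
           (runs-translate M c (card (σ ⊕ w)) short)
           (Cross-flip σ M (fibre ⟨ σ ∣_, w ⟩ c P) Q w c (λ A B h → cross A B (proj₁ (to (T-∧ {P A}) h)))
             λ A h → ≡ᵇ⇒≡ ⟨ σ ∣ A , w ⟩ c (proj₂ (to (T-∧ {P A}) h)))
           bal ⟩
    2 ^ᴺ m * (suc m * (suc N * f)) ∎

-- Exponential bound, with densities as integer inequalities.

mono-density : ∀ a b c d D p u q r X →
  a * p ≤ b * u → c * q ≤ d * r → D * (u * r) ≤ X → (a * c) * (D * (p * q)) ≤ (b * d) * X
mono-density a b c d D p u q r X ap≤bu cq≤dr bound = begin
  (a * c) * (D * (p * q))  ≡⟨ e a c D p q ⟩
  D * ((a * p) * (c * q))  ≤⟨ *-monoʳ-≤ D (*-mono-≤ ap≤bu cq≤dr) ⟩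
  D * ((b * u) * (d * r))  ≡⟨ e b d D u r ⟨
  (b * d) * (D * (u * r))  ≤⟨ *-monoʳ-≤ (b * d) bound ⟩
  (b * d) * X              ∎
  where
  open ≤-Reasoning
  e : ∀ a c D p q → (a * c) * (D * (p * q)) ≡ D * ((a * p) * (c * q))
  e = solve-∀

codensity : ∀ d e x y → (d + e) * x ≤ d * (x + y) → e * (x + y) ≤ (d + e) * y
codensity d e x y sparse = +-cancelˡ-≤ (d * (x + y)) _ _ (begin
  d * (x + y) + e * (x + y)  ≡⟨ e₁ d e x y ⟩
  (d + e) * x + (d + e) * y  ≤⟨ +-monoˡ-≤ ((d + e) * y) sparse ⟩
  d * (x + y) + (d + e) * y  ∎)
  where
  open ≤-Reasoning
  e₁ : ∀ d e x y → d * (x + y) + e * (x + y) ≡ (d + e) * x + (d + e) * y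
  e₁ = solve-∀

-- Weakens the constant e/c to β/α; for concrete numerals the comparison of the two is decided by
-- computation.
ratio-≤ : ∀ c e α β .{{_ : NonZero c}} T X → α * e ≤ β * c → c * T ≤ e * X → α * T ≤ β * X
ratio-≤ c e α β T X αe≤βc cT≤eX = *-cancelˡ-≤ c (begin
  c * (α * T)  ≡⟨ e₁ c α T ⟩
  α * (c * T)  ≤⟨ *-monoʳ-≤ α cT≤eX ⟩
  α * (e * X)  ≡⟨ *-assoc α e X ⟨
  (α * e) * X  ≤⟨ *-monoˡ-≤ X αe≤βc ⟩
  (β * c) * X  ≡⟨ e₂ c β X ⟩
  c * (β * X)  ∎)
  where
  open ≤-Reasoning
  e₁ : ∀ c α T → c * (α * T) ≡ α * (c * T)
  e₁ = solve-∀
  e₂ : ∀ c β X → (β * c) * X ≡ c * (β * X)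
  e₂ = solve-∀

-- The term `y` comes from shorter runs, where the bound `Y` is smaller by the factor `k`. As ce ≤
-- k, it costs only one more unit in the numerator of d/c.
add-small : ∀ c d e k x y X Y →
  c * e ≤ k → X ≡ k * Y → c * x ≤ d * X → y ≤ e * Y → c * (x + y) ≤ (d + 1) * X
add-small c d e k x y X Y ce≤k X≡kY cx≤dX y≤eY = begin
  c * (x + y)      ≡⟨ *-distribˡ-+ c x y ⟩
  c * x + c * y    ≤⟨ +-mono-≤ cx≤dX (begin
                        c * y        ≤⟨ *-monoʳ-≤ c y≤eY ⟩
                        c * (e * Y)  ≡⟨ *-assoc c e Y ⟨
                        (c * e) * Y  ≤⟨ *-monoˡ-≤ Y ce≤k ⟩
                        k * Y        ≡⟨ X≡kY ⟨
                        X            ∎) ⟩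
  d * X + X        ≡⟨ e₁ d X ⟩
  (d + 1) * X      ∎
  where
  open ≤-Reasoning
  e₁ : ∀ d X → d * X + X ≡ (d + 1) * X
  e₁ = solve-∀

dense-bottom : ∀ D u w q₀ q₁ X Y → w ≤ u →
  D * (u * q₀) ≤ X → D * (w * q₁) ≤ Y → X ≡ 10000 * Y → 381 * (q₀ + q₁) ≤ 1000 * q₀ →
  1000 * (D * ((u + w) * (q₀ + q₁))) ≤ 2631 * X
dense-bottom D u w q₀ q₁ X Y w≤u uq₀ wq₁ X≡ dense with ≤-total (5 * q₁) (1 * (q₁ + q₀))
-- If q₁ is at most a fifth, the crude w ≤ u suffices: the factor is 2 · 5/4 = 2.5.
... | inj₁ small = ratio-≤ 4 10 1000 2631 (D * ((u + w) * (q₀ + q₁))) X (≤ᵇ⇒≤ 10000 10524 _)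
  (mono-density 1 2 4 5 D (u + w) u (q₀ + q₁) q₀ X
    u+w≤2u (subst (λ q → 4 * q ≤ 5 * q₀) (+-comm q₁ q₀) (codensity 1 4 q₁ q₀ small)) uq₀)
  where
  u+w≤2u : 1 * (u + w) ≤ 2 * u
  u+w≤2u = ≤-trans (≤-reflexive (*-identityˡ (u + w)))
    (+-monoʳ-≤ u (≤-trans w≤u (≤-reflexive (sym (+-identityʳ u)))))
-- Otherwise w(q₀ + q₁) is at most 5wq₁, which is negligible, and the factor is 1001/381 < 2.628.
... | inj₂ large = ratio-≤ 381 1001 1000 2631 (D * ((u + w) * (q₀ + q₁))) X (≤ᵇ⇒≤ 1001000 1002411 _)
  (subst (λ T → 381 * T ≤ 1001 * X) (sym (e₁ D u w (q₀ + q₁)))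
    (add-small 381 1000 5 10000 (D * (u * (q₀ + q₁))) (D * (w * (q₀ + q₁))) X Y (≤ᵇ⇒≤ 1905 10000 _) X≡
      (mono-density 1 1 381 1000 D u u (q₀ + q₁) q₀ X ≤-refl dense uq₀)
      (subst (_≤ 5 * Y) (*-identityˡ (D * (w * (q₀ + q₁))))
        (mono-density 1 1 1 5 D w w (q₀ + q₁) q₁ Y ≤-refl
          (subst (λ q → 1 * q ≤ 5 * q₁) (+-comm q₁ q₀) large) wq₁))))
  where
  e₁ : ∀ D u w q → D * ((u + w) * q) ≡ D * (u * q) + D * (w * q)
  e₁ = solve-∀

-- Both upper halves have density at least 0.619, and 1/0.619² < 2.61. The threshold 0.381 lies just
-- below 1/φ², which leaves the dense case room for its negligible term.
dense-tops : ∀ D p₀ p₁ q₀ q₁ X → D * (p₁ * q₁) ≤ X →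
  1000 * p₀ ≤ 381 * (p₀ + p₁) → 1000 * q₀ ≤ 381 * (q₀ + q₁) →
  1000 * (D * ((p₀ + p₁) * (q₀ + q₁))) ≤ 2631 * X
dense-tops D p₀ p₁ q₀ q₁ X top p₀-sparse q₀-sparse =
  ratio-≤ 383161 1000000 1000 2631 (D * ((p₀ + p₁) * (q₀ + q₁))) X (≤ᵇ⇒≤ 1000000000 1008096591 _)
    (mono-density 619 1000 619 1000 D (p₀ + p₁) p₁ (q₀ + q₁) q₁ X
      (codensity 381 619 p₀ p₁ p₀-sparse) (codensity 381 619 q₀ q₁ q₀-sparse) top)

-- The rate per dimension is β/α, `κ` is the cost per unit of `l`, and θ/η is the density threshold.
-- The multiplier `D` stands for a power of `α` that clears denominators.
module Rate (α β κ θ η : ℕ) .{{_ : NonZero κ}}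
  (bottom : ∀ D u w q₀ q₁ X Y → w ≤ u →
    D * (u * q₀) ≤ X → D * (w * q₁) ≤ Y → X ≡ κ * Y → θ * (q₀ + q₁) ≤ η * q₀ →
    α * (D * ((u + w) * (q₀ + q₁))) ≤ β * X)
  (tops : ∀ D p₀ p₁ q₀ q₁ X → D * (p₁ * q₁) ≤ X →
    η * p₀ ≤ θ * (p₀ + p₁) → η * q₀ ≤ θ * (q₀ + q₁) →
    α * (D * ((p₀ + p₁) * (q₀ + q₁))) ≤ β * X)
  where

  RateBound : ℕ → ℕ → Set₁
  RateBound m l = ∀ (σ : Subset m) M P Q → RunsAtMost M l → Cross σ M P Q →
    α ^ᴺ m * (size P * size Q) ≤ β ^ᴺ m * κ ^ᴺ l

  module _ {m l : ℕ} (ih : RateBound m (suc l)) (ih′ : RateBound m l)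
           (s : Bool) (σ : Subset m) (M : Pred ℕ 0ℓ) (short : RunsAtMost M (suc l)) where

    private
      D X Y : ℕ
      D = α ^ᴺ m
      X = β ^ᴺ m * κ ^ᴺ suc l
      Y = β ^ᴺ m * κ ^ᴺ l

      exchange : ∀ k x y → x * (k * y) ≡ k * (x * y)
      exchange = solve-∀

    rate-bottom : ∀ P Q → Cross (s ∷ σ) M P Q → θ * size Q ≤ η * size (Q ₀) →
      α * (D * (size P * size Q)) ≤ β * X
    rate-bottom P Q cross dense =
      subst (λ p → α * (D * (p * size Q)) ≤ β * X) (size-⊔-⊓ (P ₀) (P ₁))
        (bottom D (size (P ₀ ⊔ᶠ P ₁)) (size (P ₀ ⊓ᶠ P ₁)) (size (Q ₀)) (size (Q ₁)) X Y
          (size-⊓≤⊔ (P ₀) (P ₁))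
          (ih σ (shift (bit (s xor false)) M) (P ₀ ⊔ᶠ P ₁) (Q ₀)
            (runs-shift M (bit (s xor false)) short) (Cross-⊔ s σ M P Q cross))
          (ih′ σ (doubled M) (P ₀ ⊓ᶠ P ₁) (Q ₁) (runs-doubled M short) (Cross-⊓ s σ M P Q cross))
          (exchange κ (β ^ᴺ m) (κ ^ᴺ l))
          dense)

    rate-step : ∀ P Q → Cross (s ∷ σ) M P Q → α * (D * (size P * size Q)) ≤ β * X
    rate-step P Q cross
      with ≤-total (θ * size Q) (η * size (Q ₀)) | ≤-total (θ * size P) (η * size (P ₀))
    ... | inj₁ dense    | _             = rate-bottom P Q cross dense
    ... | inj₂ _        | inj₁ dense    =
      subst (λ T → α * (D * T) ≤ β * X) (*-comm (size Q) (size P))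
        (rate-bottom Q P (Cross-sym (s ∷ σ) M cross) dense)
    ... | inj₂ q-sparse | inj₂ p-sparse =
      tops D (size (P ₀)) (size (P ₁)) (size (Q ₀)) (size (Q ₁)) X
        (ih σ (shift (bit (s xor true)) M) (P ₁) (Q ₁)
          (runs-shift M (bit (s xor true)) short) (Cross-₁₁ s σ M P Q cross))
        p-sparse q-sparse

  rate-bound : ∀ m l → RateBound m l
  rate-bound m zero σ M P Q short cross = begin
    α ^ᴺ m * (size P * size Q)  ≡⟨ cong (α ^ᴺ m *_) (Cross-empty σ M P Q short cross) ⟩
    α ^ᴺ m * 0                  ≡⟨ *-zeroʳ (α ^ᴺ m) ⟩
    0                          ≤⟨ z≤n ⟩
    β ^ᴺ m * κ ^ᴺ 0              ∎
    where open ≤-Reasoning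
  rate-bound zero (suc l) σ M P Q short cross =
    *-monoʳ-≤ 1 (≤-trans (*-mono-≤ (size-[]≤1 P) (size-[]≤1 Q)) (m^n>0 κ (suc l)))
  rate-bound (suc m) (suc l) (s ∷ σ) M P Q short cross = begin
    α ^ᴺ suc m * (size P * size Q)     ≡⟨ *-assoc α (α ^ᴺ m) (size P * size Q) ⟩
    α * (α ^ᴺ m * (size P * size Q))
      ≤⟨ rate-step (rate-bound m (suc l)) (rate-bound m l) s σ M short P Q cross ⟩
    β * (β ^ᴺ m * κ ^ᴺ suc l)           ≡⟨ *-assoc β (β ^ᴺ m) (κ ^ᴺ suc l) ⟨
    β ^ᴺ suc m * κ ^ᴺ suc l             ∎
    where open ≤-Reasoning

open Rate 1000 2631 10000 381 1000 dense-bottom dense-tops using (rate-bound)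

-- Natural numbers as rationals, and membership in the real cuts.

ι : ℕ → ℚ
ι n = ℚ.mkℚ (+ n) 0 (Coprime.sym (1-coprimeTo n))

-- `ι n` is a reduced fraction by construction, so `↥` and `↧ₙ` compute on it even for a variable
-- `n`; `log₂` and `2^ℚ_` inspect both.
fromℕ≡ι : ∀ n → fromℕ n ≡ ι n
fromℕ≡ι n = ℚ.normalize-coprime (Coprime.sym (1-coprimeTo n))

ι-* : ∀ m n → ι (m * n) ≡ ι m ℚ.* ι n
ι-* m n = trans (sym (fromℕ≡ι (m * n))) (cong (ℚ._/ 1) (ℤ.pos-* m n))

ι-+ : ∀ m n → ι (m + n) ≡ ι m ℚ.+ ι n
ι-+ m n = trans (sym (fromℕ≡ι (m + n)))
  (cong (ℚ._/ 1) (sym (cong₂ ℤ._+_ (ℤ.*-identityʳ (+ m)) (ℤ.*-identityʳ (+ n)))))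

ι-mono-< : ∀ {m n} → m < n → ι m ℚ.< ι n
ι-mono-< {m} {n} m<n = ℚ.*<*
  (subst₂ ℤ._<_ (sym (ℤ.*-identityʳ (+ m))) (sym (ℤ.*-identityʳ (+ n))) (ℤ.+<+ m<n))

ι-mono-≤ : ∀ {m n} → m ≤ n → ι m ℚ.≤ ι n
ι-mono-≤ {m} {n} m≤n = ℚ.*≤*
  (subst₂ ℤ._≤_ (sym (ℤ.*-identityʳ (+ m))) (sym (ℤ.*-identityʳ (+ n))) (ℤ.+≤+ m≤n))

fromℕ-mono-< : ∀ {m n} → m < n → fromℕ m ℚ.< fromℕ n
fromℕ-mono-< {m} {n} m<n = subst₂ ℚ._<_ (sym (fromℕ≡ι m)) (sym (fromℕ≡ι n)) (ι-mono-< m<n)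

fromℕ-* : ∀ m n → fromℕ (m * n) ≡ fromℕ m ℚ.* fromℕ n
fromℕ-* m n = trans (fromℕ≡ι (m * n)) (trans (ι-* m n) (sym (cong₂ ℚ._*_ (fromℕ≡ι m) (fromℕ≡ι n))))

fromℕ-^ : ∀ m k → fromℕ (m ^ᴺ k) ≡ fromℕ m ^ k
fromℕ-^ m zero    = refl
fromℕ-^ m (suc k) = trans (fromℕ-* m (m ^ᴺ k)) (cong (fromℕ m ℚ.*_) (fromℕ-^ m k))

-- Multiplying by the nth power of `d` clears the denominator of r = c/d.
fraction-bound : ∀ {r c d} x n y → r ℚ.* fromℕ d ≡ fromℕ c → d ^ᴺ n * x < c ^ᴺ n * y →
  fromℕ x ℚ.< r ^ n ℚ.* fromℕ y
fraction-bound {r} {c} {d} x n y rd≡c lt =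
  ℚ.*-cancelˡ-<-nonNeg (fromℕ (d ^ᴺ n)) {{subst ℚ.NonNegative (sym (fromℕ≡ι (d ^ᴺ n))) _}}
    (subst₂ ℚ._<_ (fromℕ-* (d ^ᴺ n) x) eq (fromℕ-mono-< lt))
  where
  open ≡-Reasoning
  open Exp (CommutativeRing.commutativeSemiring ℚ.+-*-commutativeRing) using (^-distrib-*)
  eq : fromℕ (c ^ᴺ n * y) ≡ fromℕ (d ^ᴺ n) ℚ.* (r ^ n ℚ.* fromℕ y)
  eq = begin
    fromℕ (c ^ᴺ n * y)               ≡⟨ fromℕ-* (c ^ᴺ n) y ⟩
    fromℕ (c ^ᴺ n) ℚ.* fromℕ y           ≡⟨ cong (ℚ._* fromℕ y) (fromℕ-^ c n) ⟩
    fromℕ c ^ n ℚ.* fromℕ y               ≡⟨ cong (λ z → z ^ n ℚ.* fromℕ y) rd≡c ⟨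
    (r ℚ.* fromℕ d) ^ n ℚ.* fromℕ y         ≡⟨ cong (λ z → z ^ n ℚ.* fromℕ y) (ℚ.*-comm r (fromℕ d)) ⟩
    (fromℕ d ℚ.* r) ^ n ℚ.* fromℕ y         ≡⟨ cong (ℚ._* fromℕ y) (^-distrib-* (fromℕ d) r n) ⟩
    (fromℕ d ^ n ℚ.* r ^ n) ℚ.* fromℕ y     ≡⟨ ℚ.*-assoc (fromℕ d ^ n) (r ^ n) (fromℕ y) ⟩
    fromℕ d ^ n ℚ.* (r ^ n ℚ.* fromℕ y)     ≡⟨ cong (ℚ._* (r ^ n ℚ.* fromℕ y)) (fromℕ-^ d n) ⟨
    fromℕ (d ^ᴺ n) ℚ.* (r ^ n ℚ.* fromℕ y) ∎

log₂-lower : ∀ {k n} → 2 ^ᴺ k < n → ι k <ᴿ log₂ n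
log₂-lower {k} {n} 2^k<n =
  subst₂ ℚ._<_ (fromℕ-^ 2 k) (sym (ℚ.*-identityʳ (fromℕ n))) (fromℕ-mono-< {2 ^ᴺ k} 2^k<n)

2^ᴿ-upper : ∀ {y k r} → y < 2 ^ᴺ k → ι k <ᴿ r → fromℕ y <ᴿ 2^ᴿ r
2^ᴿ-upper {y} {k} y<2^k k<r = ι k , k<r ,
  inj₂ (subst₂ ℚ._<_ (sym (ℚ.*-identityʳ (fromℕ y))) (fromℕ-^ 2 k) (fromℕ-mono-< {y} {2 ^ᴺ k} y<2^k))

-- Each real of the bound is approximated from below by an integer: n by n − 1,
-- 2l by 2l − 1 and log n by k.
exponent-lower : ∀ {n l k c} → 2 ^ᴺ k < suc n → c ≤ suc (2 * l) * (k * k) →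
  ι (n + c) <ᴿ ratᴿ (fromℕ (suc n)) +ᴿ ratᴿ (fromℕ (2 * suc l)) *ᴿ (log₂ (suc n) *ᴿ log₂ (suc n))
exponent-lower {n} {l} {k} {c} 2^k<n c≤ =
  ι n , ι c , ι<fromℕ ≤-refl ,
  inj₂ (ι (suc (2 * l)) , ι (k * k) , ι-mono-≤ z≤n , ι-mono-≤ z≤n ,
        ι<fromℕ (≤-reflexive (e l)) ,
        inj₂ (ι k , ι k , ι-mono-≤ z≤n , ι-mono-≤ z≤n , log₂-lower {k} 2^k<n , log₂-lower {k} 2^k<n ,
              ℚ.≤-reflexive (ι-* k k)) ,
        ℚ.≤-trans (ι-mono-≤ c≤) (ℚ.≤-reflexive (ι-* (suc (2 * l)) (k * k)))) ,
  ℚ.≤-reflexive (ι-+ n c)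
  where
  ι<fromℕ : ∀ {a b} → a < b → ι a ℚ.< fromℕ b
  ι<fromℕ {a} {b} a<b = subst (ι a ℚ.<_) (sym (fromℕ≡ι b)) (ι-mono-< a<b)
  e : ∀ l → suc (suc (2 * l)) ≡ 2 * suc l
  e = solve-∀

-- From listed families to Boolean functions.

_∈?_ : (A : Subset n) (xs : List (Subset n)) → Dec (A ∈ xs)
_∈?_ = DecMembership._∈?_ (≡-dec Bool._≟_)

indicator : List (Subset n) → 𝔽 n
indicator xs A = isYes (A ∈? xs)

-- Since entries do not repeat, each head is a new point and raises the size strictly.
length≤size : {xs : List (Subset n)} → Unique xs → length xs ≤ size (indicator xs)
length≤size [] = z≤n
length≤size {xs = x ∷ xs} (x∉xs ∷ unique) = ≤-<-trans (length≤size unique)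
  (size-mono-< (indicator xs) (indicator (x ∷ xs))
    (λ A h → fromWitness {a? = A ∈? (x ∷ xs)} (there (toWitness {a? = A ∈? xs} h)))
    x (All¬⇒¬Any x∉xs ∘ toWitness {a? = x ∈? xs}) (fromWitness {a? = x ∈? (x ∷ xs)} (here refl)))

-- The lower inequality is strict because membership of `k` in the cut of the logarithm is; an exact
-- power of two therefore belongs to the bracket below it.
log-bracket : ∀ n → ∃[ k ] 2 ^ᴺ k < 2 + n × 2 + n ≤ 2 ^ᴺ suc k
log-bracket zero = 0 , ≤-refl , ≤-refl
log-bracket (suc n) with log-bracket n
... | k , lower , upper with m≤n⇒m<n∨m≡n upper
...   | inj₁ 2+n<2^1+k = k , m<n⇒m<1+n lower , 2+n<2^1+k
...   | inj₂ 2+n≡2^1+k = suc k , ≤-reflexive (cong suc (sym 2+n≡2^1+k)) ,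
  ≤-trans (s≤s (≤-reflexive 2+n≡2^1+k)) (≤-trans (+-monoˡ-≤ (2 ^ᴺ suc k) (m^n>0 2 (suc k)))
    (≤-reflexive (cong (_+_ (2 ^ᴺ suc k)) (sym (+-identityʳ (2 ^ᴺ suc k))))))

module _ {n l : ℕ} (M : Pred ℕ 0ℓ) (length≡ : HasLength M l)
         (𝒜 ℬ : Family n) (intersecting : Intersecting M 𝒜 ℬ) where

  private
    P Q : 𝔽 n
    P = indicator (members 𝒜)
    Q = indicator (members ℬ)

    short : RunsAtMost M l
    short = proj₂ length≡

    -- With all signs positive the signed count is the cardinality itself.
    cross : Cross ∅ M P Q
    cross A B PA QB = subst M (cong card (sym (zipWith-identityˡ Bool.xor-identityˡ (A ∩ B))))
      (intersecting A B (toWitness {a? = A ∈? members 𝒜} PA) (toWitness {a? = B ∈? members ℬ} QB))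

    product≤ : ∥ 𝒜 ∥ * ∥ ℬ ∥ ≤ size P * size Q
    product≤ = *-mono-≤ (length≤size (unique 𝒜)) (length≤size (unique ℬ))

  product-rate : 1000 ^ᴺ n * (∥ 𝒜 ∥ * ∥ ℬ ∥) ≤ 2631 ^ᴺ n * 10000 ^ᴺ l
  product-rate = ≤-trans (*-monoʳ-≤ (1000 ^ᴺ n) product≤) (rate-bound n l ∅ M P Q short cross)

  product-polynomial : ∥ 𝒜 ∥ * ∥ ℬ ∥ ≤ 2 ^ᴺ n * (suc n ^ᴺ 3) ^ᴺ l
  product-polynomial = ≤-trans product≤ (polynomial-bound n l n ≤-refl ∅ M P Q short cross)

  product-zero : l ≡ 0 → ∥ 𝒜 ∥ * ∥ ℬ ∥ ≡ 0
  product-zero refl = n≤0⇒n≡0 (≤-trans product≤ (≤-reflexive (Cross-empty ∅ M P Q short cross)))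

-- Comparison of exponents and the two final bounds.

exponent-arith : ∀ {k} l → 6 ≤ k → 3 * (2 + k) * suc l + 2 ≤ suc (2 * l) * (k * k)
exponent-arith l 6≤k with m≤n⇒∃[o]m+o≡n 6≤k
-- For k = 6 + j the difference of the two sides is this polynomial with nonnegative coefficients.
... | j , refl = ≤-trans (m≤m+n _ (10 + 9 * j + j * j + 48 * l + 21 * (l * j) + 2 * (l * (j * j))))
                         (≤-reflexive (e j l))
  where
  e : ∀ j l → 3 * (2 + (6 + j)) * suc l + 2 + (10 + 9 * j + j * j + 48 * l + 21 * (l * j) + 2 * (l * (j * j)))
            ≡ suc (2 * l) * ((6 + j) * (6 + j))
  e = solve-∀

poly≤exp : ∀ {n k} l → n ≤ 2 ^ᴺ suc k → 2 ^ᴺ n * (suc n ^ᴺ 3) ^ᴺ suc l < 2 ^ᴺ (n + (3 * (2 + k) * suc l + 1))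
poly≤exp {n} {k} l n≤ = begin-strict
  2 ^ᴺ n * (suc n ^ᴺ 3) ^ᴺ suc l             ≤⟨ *-monoʳ-≤ (2 ^ᴺ n) (^-monoˡ-≤ (suc l) (^-monoˡ-≤ 3 1+n≤)) ⟩
  2 ^ᴺ n * ((2 ^ᴺ (2 + k)) ^ᴺ 3) ^ᴺ suc l     ≡⟨ cong (λ z → 2 ^ᴺ n * z ^ᴺ suc l) (^-*-assoc 2 (2 + k) 3) ⟩
  2 ^ᴺ n * (2 ^ᴺ ((2 + k) * 3)) ^ᴺ suc l     ≡⟨ cong (2 ^ᴺ n *_) (^-*-assoc 2 ((2 + k) * 3) (suc l)) ⟩
  2 ^ᴺ n * 2 ^ᴺ ((2 + k) * 3 * suc l)       ≡⟨ ^-distribˡ-+-* 2 n ((2 + k) * 3 * suc l) ⟨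
  2 ^ᴺ (n + (2 + k) * 3 * suc l)           <⟨ ^-monoʳ-< 2 ≤-refl (≤-reflexive (e n k l)) ⟩
  2 ^ᴺ (n + (3 * (2 + k) * suc l + 1))     ∎
  where
  open ≤-Reasoning
  1+n≤ : suc n ≤ 2 ^ᴺ (2 + k)
  1+n≤ = ≤-trans (+-mono-≤ (m^n>0 2 (suc k)) n≤) (≤-reflexive (cong (_+_ (2 ^ᴺ suc k)) (sym (+-identityʳ _))))
  e : ∀ n k l → suc (n + (2 + k) * 3 * suc l) ≡ n + (3 * (2 + k) * suc l + 1)
  e = solve-∀

-- The exponent -1 is a witness: it is 0 + (-1), where 0 < n + 1 and -1 lies in the cut of the zero
-- product through its negative disjunct.
zero-bound : ∀ n {s} → fromℕ 0 <ᴿ 2^ᴿ (ratᴿ (fromℕ (suc n)) +ᴿ ratᴿ (fromℕ 0) *ᴿ s)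
zero-bound n = ℚ.- ℚ.1ℚ ,
  (ι 0 , ℚ.- ℚ.1ℚ , subst (ι 0 ℚ.<_) (sym (fromℕ≡ι (suc n))) (ι-mono-< z<s) ,
    inj₁ (ℚ.negative⁻¹ (ℚ.- ℚ.1ℚ)) , ℚ.≤-refl) ,
  inj₂ (ℚ.positive⁻¹ ℚ.½)

theorem2 : (∀ (n : ℕ) → 1 ≤ n →
    ∀ (M : Pred ℕ 0ℓ) (l : ℕ) → M ⊆ [ n ] → HasLength M l →
    ∀ (𝒜 ℬ : Family n) → Intersecting M 𝒜 ℬ →
    fromℕ (∥ 𝒜 ∥ * ∥ ℬ ∥) ℚ.< (+ 2631 ℚ./ 1000) ^ n ℚ.* fromℕ 10 ^ (4 * l + 10))
    ×
    (∃[ N ] ∀ (n : ℕ) → 1 ≤ n → N ≤ n →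
    ∀ (M : Pred ℕ 0ℓ) (l : ℕ) → M ⊆ [ n ] → HasLength M l →
    ∀ (𝒜 ℬ : Family n) → Intersecting M 𝒜 ℬ →
    fromℕ (∥ 𝒜 ∥ * ∥ ℬ ∥) <ᴿ 2^ᴿ (ratᴿ (fromℕ n) +ᴿ ratᴿ (fromℕ (2 * l)) *ᴿ (log₂ n *ᴿ log₂ n)))
-- As 65 exceeds the sixth power of 2, the bracket exponent `k` is at least 6.
theorem2 = exponential , 65 , quasipolynomial
  where
  exponential : ∀ (n : ℕ) → 1 ≤ n →
    ∀ (M : Pred ℕ 0ℓ) (l : ℕ) → M ⊆ [ n ] → HasLength M l →
    ∀ (𝒜 ℬ : Family n) → Intersecting M 𝒜 ℬ →
    fromℕ (∥ 𝒜 ∥ * ∥ ℬ ∥) ℚ.< (+ 2631 ℚ./ 1000) ^ n ℚ.* fromℕ 10 ^ (4 * l + 10)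
  exponential n _ M l _ length≡ 𝒜 ℬ intersecting =
    subst (λ z → fromℕ (∥ 𝒜 ∥ * ∥ ℬ ∥) ℚ.< (+ 2631 ℚ./ 1000) ^ n ℚ.* z)
      (fromℕ-^ 10 (4 * l + 10))
      (fraction-bound {+ 2631 ℚ./ 1000} {2631} {1000} (∥ 𝒜 ∥ * ∥ ℬ ∥) n (10 ^ᴺ (4 * l + 10)) refl
        (≤-<-trans (product-rate M length≡ 𝒜 ℬ intersecting)
          (*-monoʳ-< (2631 ^ᴺ n) {{m^n≢0 2631 n}}
            (subst (_< 10 ^ᴺ (4 * l + 10)) (sym (^-*-assoc 10 4 l))
              (^-monoʳ-< 10 (s≤s z<s) (m<m+n (4 * l) z<s))))))

  quasipolynomial : ∀ (n : ℕ) → 1 ≤ n → 65 ≤ n →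
    ∀ (M : Pred ℕ 0ℓ) (l : ℕ) → M ⊆ [ n ] → HasLength M l →
    ∀ (𝒜 ℬ : Family n) → Intersecting M 𝒜 ℬ →
    fromℕ (∥ 𝒜 ∥ * ∥ ℬ ∥) <ᴿ 2^ᴿ (ratᴿ (fromℕ n) +ᴿ ratᴿ (fromℕ (2 * l)) *ᴿ (log₂ n *ᴿ log₂ n))
  quasipolynomial (suc n) _ _ M zero _ length≡ 𝒜 ℬ intersecting =
    subst (λ y → fromℕ y <ᴿ 2^ᴿ (ratᴿ (fromℕ (suc n)) +ᴿ ratᴿ (fromℕ 0) *ᴿ (log₂ (suc n) *ᴿ log₂ (suc n))))
      (sym (product-zero M length≡ 𝒜 ℬ intersecting refl)) (zero-bound n)
  quasipolynomial (suc zero) _ (s≤s ())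
  quasipolynomial (suc (suc n)) _ 65≤n M (suc l) _ length≡ 𝒜 ℬ intersecting with log-bracket n
  ... | k , lower , upper =
    -- The summand 2 pays one unit for the strict inequality and one for the dimension n + 2, which
    -- enters its open cut only as n + 1.
    2^ᴿ-upper {∥ 𝒜 ∥ * ∥ ℬ ∥} {suc n + (3 * (2 + k) * suc l + 2)}
      (≤-<-trans (product-polynomial M length≡ 𝒜 ℬ intersecting)
        (subst (λ c → 2 ^ᴺ (2 + n) * (suc (2 + n) ^ᴺ 3) ^ᴺ suc l < 2 ^ᴺ c)
          (e n (3 * (2 + k) * suc l)) (poly≤exp {k = k} l upper)))
      (exponent-lower {suc n} {l} {k} lower (exponent-arith l (s≤s⁻¹ 7≤1+k)))
    where
    e : ∀ n x → (2 + n) + (x + 1) ≡ suc n + (x + 2)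
    e = solve-∀
    7≤1+k : 7 ≤ suc k
    7≤1+k = ≮⇒≥ λ 1+k<7 → <⇒≱ 65≤n (≤-trans upper (^-monoʳ-≤ 2 (s≤s⁻¹ 1+k<7)))
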